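{- Let $m\ge 1$ and let $s_1,\dots,s_{2m}$ be positive integers. Put $S=\sum_{i=1}^{2m}s_i$, $s_{\max}=\max_i s_i$, $M=S+1$, $d_i=s_{\max}-s_i$, and $\epsilon=\frac{1}{2M}$. Let $$P_R=\Big\{x\in\mathbb{R}^{2m}:\ 0\le x_i\le 1\ \forall i,\ \sum_{i=1}^{2m}(M+s_i)x_i\le \tfrac12 S+mM+\epsilon,\ \sum_{i=1}^{2m}(M+d_i)x_i\le \tfrac12\sum_{i=1}^{2m}d_i+mM+\epsilon\Big\}.$$ Suppose $\sum_{j=1}^{m}s_j=\frac S2$ (so that $\{s_1,\dots,s_m\}$ and $\{s_{m+1},\dots,s_{2m}\}$ form an exact partition). Let $v^*$ be a vertex of $P_R$ with exactly $2m-1$ coordinates in $\{0,1\}$, such that $\{j: v^*_j=1\}=\{1,\dots,m\}$ and whose unique fractional coordinate index $i$ (with $0<v^*_i<1$, necessarily $i\in\{m+1,\dots,2m\}$) satisfies $s_i=\frac{s_{\max}}{2}$. Then $v^*$ is degenerate: both knapsack inequalities are active at $v^*$ in addition to $2m-1$ box constraints, so $2m+1$ defining inequalities are active at $v^*$.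
   Context: The inequalities $0\le x_i\le1$ are the box constraints; the other two inequalities are the knapsack constraints. A vertex of $P_R$ is degenerate if more than $2m$ of the $4m+2$ defining inequalities are active at it. -}

module Defs where

open import Algebra.Bundles.Raw using (RawMonoid)
import Algebra.Definitions.RawMonoid as RawMonoidSum
open import Data.Fin.Base using (Fin)
open import Data.Integer.Base using (+_)
open import Data.List.Base using (List; length)
open import Data.List.Membership.Propositional using (_∈_)
open import Data.List.Relation.Unary.Unique.Propositional using (Unique)
open import Data.Nat.Base as ℕ using (ℕ; suc; _⊔_; _∸_)
import Data.Nat.Properties as ℕ
open import Data.Product.Base using (Σ-syntax; ∃-syntax; _×_; _,_)
open import Data.Rational.Base as ℚ using (ℚ; 0ℚ; 1ℚ; ½; ∣_∣; _/_; 1/_)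
import Data.Rational.Properties as ℚ
open import Data.Rational.Solver using (module +-*-Solver)
open import Data.Vec.Functional using (Vector; foldr)
open import Function.Bundles using (_⇔_)
open import Relation.Binary.PropositionalEquality
  using (_≡_; refl; sym; trans; cong; cong₂; subst)

-- Real numbers: Cauchy sequences of rationals, with equality _≈_ given by
-- null differences.

Eventually : (ℕ → Set) → Set
Eventually P = ∃[ N ] ∀ n → N ℕ.≤ n → P n

IsCauchy : (ℕ → ℚ) → Set
IsCauchy a = ∀ ε → 0ℚ ℚ.< ε →
  ∃[ N ] ∀ p q → N ℕ.≤ p → N ℕ.≤ q → ∣ a p ℚ.- a q ∣ ℚ.≤ ε

record ℝ : Set where
  constructor mkℝ
  field
    seq    : ℕ → ℚ
    cauchy : IsCauchy seq
open ℝ public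

infix 4 _≈_ _≤_ _<_

_≈_ _≤_ _<_ : ℝ → ℝ → Set
x ≈ y = ∀ ε → 0ℚ ℚ.< ε → Eventually λ n → ∣ seq x n ℚ.- seq y n ∣ ℚ.≤ ε
x ≤ y = ∀ ε → 0ℚ ℚ.< ε → Eventually λ n → seq x n ℚ.≤ seq y n ℚ.+ ε
x < y = ∃[ ε ] (0ℚ ℚ.< ε × Eventually λ n → seq x n ℚ.+ ε ℚ.≤ seq y n)

private
  open +-*-Solver
  open ℚ.≤-Reasoning

  const-cauchy : ∀ q → IsCauchy (λ _ → q)
  const-cauchy q ε 0<ε = 0 , λ _ _ _ _ → begin
    ∣ q ℚ.- q ∣  ≡⟨ cong ∣_∣ (ℚ.+-inverseʳ q) ⟩
    0ℚ           ≤⟨ ℚ.<⇒≤ 0<ε ⟩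
    ε            ∎

  half-pos : ∀ {ε} → 0ℚ ℚ.< ε → 0ℚ ℚ.< ½ ℚ.* ε
  half-pos {ε} 0<ε = ℚ.*-monoʳ-<-pos ½ 0<ε

  halves : ∀ ε → ½ ℚ.* ε ℚ.+ ½ ℚ.* ε ≡ ε
  halves ε = trans (sym (ℚ.*-distribʳ-+ ε ½ ½)) (ℚ.*-identityˡ ε)

  +-cauchy : ∀ {a b} → IsCauchy a → IsCauchy b → IsCauchy (λ n → a n ℚ.+ b n)
  +-cauchy {a} {b} ca cb ε 0<ε
    with M , hM ← ca (½ ℚ.* ε) (half-pos 0<ε)
       | N , hN ← cb (½ ℚ.* ε) (half-pos 0<ε)
    = M ⊔ N , λ p q hp hq → begin
      ∣ (a p ℚ.+ b p) ℚ.- (a q ℚ.+ b q) ∣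
        ≡⟨ cong ∣_∣ (solve 4 (λ w x y z → (w :+ x) :- (y :+ z) := (w :- y) :+ (x :- z))
                      refl (a p) (b p) (a q) (b q)) ⟩
      ∣ (a p ℚ.- a q) ℚ.+ (b p ℚ.- b q) ∣
        ≤⟨ ℚ.∣p+q∣≤∣p∣+∣q∣ (a p ℚ.- a q) (b p ℚ.- b q) ⟩
      ∣ a p ℚ.- a q ∣ ℚ.+ ∣ b p ℚ.- b q ∣
        ≤⟨ ℚ.+-mono-≤
             (hM p q (ℕ.m⊔n≤o⇒m≤o M N hp) (ℕ.m⊔n≤o⇒m≤o M N hq))
             (hN p q (ℕ.m⊔n≤o⇒n≤o M N hp) (ℕ.m⊔n≤o⇒n≤o M N hq)) ⟩
      ½ ℚ.* ε ℚ.+ ½ ℚ.* ε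
        ≡⟨ halves ε ⟩
      ε ∎

  neg-cauchy : ∀ {a} → IsCauchy a → IsCauchy (λ n → ℚ.- a n)
  neg-cauchy {a} ca ε 0<ε with N , hN ← ca ε 0<ε = N , λ p q hp hq → begin
    ∣ ℚ.- a p ℚ.- ℚ.- a q ∣
      ≡⟨ cong ∣_∣ (solve 2 (λ x y → :- x :- :- y := :- (x :- y)) refl (a p) (a q)) ⟩
    ∣ ℚ.- (a p ℚ.- a q) ∣  ≡⟨ ℚ.∣-p∣≡∣p∣ (a p ℚ.- a q) ⟩
    ∣ a p ℚ.- a q ∣        ≤⟨ hN p q hp hq ⟩
    ε                      ∎

  Bound : (ℕ → ℚ) → Set
  Bound a = ∃[ B ] (0ℚ ℚ.≤ B × Eventually λ n → ∣ a n ∣ ℚ.≤ B)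

  bounded : ∀ {a} → IsCauchy a → Bound a
  bounded {a} ca with N , hN ← ca 1ℚ (ℚ.positive⁻¹ 1ℚ) =
    1ℚ ℚ.+ ∣ a N ∣ ,
    ℚ.+-mono-≤ (ℚ.nonNegative⁻¹ 1ℚ) (ℚ.0≤∣p∣ (a N)) ,
    N , λ n hn → begin
      ∣ a n ∣
        ≡⟨ cong ∣_∣ (solve 2 (λ x y → x := (x :- y) :+ y) refl (a n) (a N)) ⟩
      ∣ (a n ℚ.- a N) ℚ.+ a N ∣      ≤⟨ ℚ.∣p+q∣≤∣p∣+∣q∣ (a n ℚ.- a N) (a N) ⟩
      ∣ a n ℚ.- a N ∣ ℚ.+ ∣ a N ∣    ≤⟨ ℚ.+-monoˡ-≤ ∣ a N ∣ (hN n N hn ℕ.≤-refl) ⟩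
      1ℚ ℚ.+ ∣ a N ∣                 ∎

  *-mono : ∀ {p q r s} → 0ℚ ℚ.≤ q → 0ℚ ℚ.≤ r → p ℚ.≤ q → r ℚ.≤ s → p ℚ.* r ℚ.≤ q ℚ.* s
  *-mono {q = q} {r} 0≤q 0≤r p≤q r≤s = ℚ.≤-trans
    (ℚ.*-monoʳ-≤-nonNeg r {{ℚ.nonNegative 0≤r}} p≤q)
    (ℚ.*-monoˡ-≤-nonNeg q {{ℚ.nonNegative 0≤q}} r≤s)

  divide : ∀ K → 0ℚ ℚ.< K → ∀ ε → 0ℚ ℚ.< ε → ∃[ δ ] (0ℚ ℚ.< δ × K ℚ.* δ ≡ ε)
  divide K 0<K ε 0<ε = 1/ K ℚ.* ε ,
    subst (ℚ._< 1/ K ℚ.* ε) (ℚ.*-zeroʳ (1/ K))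
      (ℚ.*-monoʳ-<-pos (1/ K) {{ℚ.1/pos⇒pos K}} 0<ε) ,
    trans (sym (ℚ.*-assoc K (1/ K) ε))
      (trans (cong (ℚ._* ε) (ℚ.*-inverseʳ K)) (ℚ.*-identityˡ ε))
    where
    instance
      K-pos : ℚ.Positive K
      K-pos = ℚ.positive 0<K

      K-nonZero : ℚ.NonZero K
      K-nonZero = ℚ.pos⇒nonZero K

  split-bound : ∀ A B δ → 0ℚ ℚ.≤ δ → A ℚ.* δ ℚ.+ B ℚ.* δ ℚ.≤ (1ℚ ℚ.+ (A ℚ.+ B)) ℚ.* δ
  split-bound A B δ 0≤δ = begin
    A ℚ.* δ ℚ.+ B ℚ.* δ              ≡⟨ ℚ.*-distribʳ-+ δ A B ⟨
    (A ℚ.+ B) ℚ.* δ                  ≡⟨ ℚ.+-identityˡ ((A ℚ.+ B) ℚ.* δ) ⟨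
    0ℚ ℚ.+ (A ℚ.+ B) ℚ.* δ           ≤⟨ ℚ.+-monoˡ-≤ ((A ℚ.+ B) ℚ.* δ) 0≤δ ⟩
    δ ℚ.+ (A ℚ.+ B) ℚ.* δ            ≡⟨ cong (ℚ._+ (A ℚ.+ B) ℚ.* δ) (ℚ.*-identityˡ δ) ⟨
    1ℚ ℚ.* δ ℚ.+ (A ℚ.+ B) ℚ.* δ     ≡⟨ ℚ.*-distribʳ-+ δ 1ℚ (A ℚ.+ B) ⟨
    (1ℚ ℚ.+ (A ℚ.+ B)) ℚ.* δ         ∎

  split : ∀ A B → 0ℚ ℚ.≤ A → 0ℚ ℚ.≤ B → ∀ ε → 0ℚ ℚ.< ε →
    ∃[ δ ] (0ℚ ℚ.< δ × A ℚ.* δ ℚ.+ B ℚ.* δ ℚ.≤ ε)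
  split A B 0≤A 0≤B ε 0<ε = go (1ℚ ℚ.+ (A ℚ.+ B)) (split-bound A B)
      (ℚ.+-mono-<-≤ (ℚ.positive⁻¹ 1ℚ) (ℚ.+-mono-≤ 0≤A 0≤B))
    where
    go : ∀ K → (∀ δ → 0ℚ ℚ.≤ δ → A ℚ.* δ ℚ.+ B ℚ.* δ ℚ.≤ K ℚ.* δ) → 0ℚ ℚ.< K →
      ∃[ δ ] (0ℚ ℚ.< δ × A ℚ.* δ ℚ.+ B ℚ.* δ ℚ.≤ ε)
    go K bound 0<K with δ , 0<δ , eq ← divide K 0<K ε 0<ε =
      δ , 0<δ , subst (A ℚ.* δ ℚ.+ B ℚ.* δ ℚ.≤_) eq (bound δ (ℚ.<⇒≤ 0<δ))

  *-difference : ∀ w x y z →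
    ∣ w ℚ.* x ℚ.- y ℚ.* z ∣ ℚ.≤ ∣ w ∣ ℚ.* ∣ x ℚ.- z ∣ ℚ.+ ∣ z ∣ ℚ.* ∣ w ℚ.- y ∣
  *-difference w x y z = begin
    ∣ w ℚ.* x ℚ.- y ℚ.* z ∣
      ≡⟨ cong ∣_∣ (solve 4 (λ w x y z → w :* x :- y :* z := w :* (x :- z) :+ z :* (w :- y))
                    refl w x y z) ⟩
    ∣ w ℚ.* (x ℚ.- z) ℚ.+ z ℚ.* (w ℚ.- y) ∣
      ≤⟨ ℚ.∣p+q∣≤∣p∣+∣q∣ (w ℚ.* (x ℚ.- z)) (z ℚ.* (w ℚ.- y)) ⟩
    ∣ w ℚ.* (x ℚ.- z) ∣ ℚ.+ ∣ z ℚ.* (w ℚ.- y) ∣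
      ≡⟨ cong₂ ℚ._+_ (ℚ.∣p*q∣≡∣p∣*∣q∣ w (x ℚ.- z)) (ℚ.∣p*q∣≡∣p∣*∣q∣ z (w ℚ.- y)) ⟩
    ∣ w ∣ ℚ.* ∣ x ℚ.- z ∣ ℚ.+ ∣ z ∣ ℚ.* ∣ w ℚ.- y ∣ ∎

  *-close : ∀ {A B δ ε} w x y z → 0ℚ ℚ.≤ A → 0ℚ ℚ.≤ B →
    A ℚ.* δ ℚ.+ B ℚ.* δ ℚ.≤ ε → ∣ w ∣ ℚ.≤ A → ∣ z ∣ ℚ.≤ B →
    ∣ x ℚ.- z ∣ ℚ.≤ δ → ∣ w ℚ.- y ∣ ℚ.≤ δ → ∣ w ℚ.* x ℚ.- y ℚ.* z ∣ ℚ.≤ ε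
  *-close w x y z 0≤A 0≤B h w≤A z≤B xz≤δ wy≤δ =
    ℚ.≤-trans (*-difference w x y z)
      (ℚ.≤-trans
        (ℚ.+-mono-≤ (*-mono 0≤A (ℚ.0≤∣p∣ (x ℚ.- z)) w≤A xz≤δ)
                    (*-mono 0≤B (ℚ.0≤∣p∣ (w ℚ.- y)) z≤B wy≤δ))
        h)

  *-cauchy′ : ∀ {a b} → Bound a → Bound b → IsCauchy a → IsCauchy b →
    IsCauchy (λ n → a n ℚ.* b n)
  *-cauchy′ {a} {b} (A , 0≤A , L , hA) (B , 0≤B , L′ , hB) ca cb ε 0<ε =
    go (split A B 0≤A 0≤B ε 0<ε)
    where
    go : ∃[ δ ] (0ℚ ℚ.< δ × A ℚ.* δ ℚ.+ B ℚ.* δ ℚ.≤ ε) →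
         ∃[ N ] ∀ p q → N ℕ.≤ p → N ℕ.≤ q → ∣ a p ℚ.* b p ℚ.- a q ℚ.* b q ∣ ℚ.≤ ε
    go (δ , 0<δ , h) = combine (ca δ 0<δ) (cb δ 0<δ)
      where
      combine :
        (∃[ N ] ∀ p q → N ℕ.≤ p → N ℕ.≤ q → ∣ a p ℚ.- a q ∣ ℚ.≤ δ) →
        (∃[ N ] ∀ p q → N ℕ.≤ p → N ℕ.≤ q → ∣ b p ℚ.- b q ∣ ℚ.≤ δ) →
        ∃[ N ] ∀ p q → N ℕ.≤ p → N ℕ.≤ q → ∣ a p ℚ.* b p ℚ.- a q ℚ.* b q ∣ ℚ.≤ ε
      combine (M , hM) (N , hN) = (L ⊔ L′) ⊔ (M ⊔ N) , λ p q hp hq →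
        *-close (a p) (b p) (a q) (b q) 0≤A 0≤B h
          (hA p (ℕ.m⊔n≤o⇒m≤o L L′ (hLL hp)))
          (hB q (ℕ.m⊔n≤o⇒n≤o L L′ (hLL hq)))
          (hN p q (ℕ.m⊔n≤o⇒n≤o M N (hMN hp)) (ℕ.m⊔n≤o⇒n≤o M N (hMN hq)))
          (hM p q (ℕ.m⊔n≤o⇒m≤o M N (hMN hp)) (ℕ.m⊔n≤o⇒m≤o M N (hMN hq)))
        where
        hLL : ∀ {k} → (L ⊔ L′) ⊔ (M ⊔ N) ℕ.≤ k → L ⊔ L′ ℕ.≤ k
        hLL = ℕ.m⊔n≤o⇒m≤o (L ⊔ L′) (M ⊔ N)

        hMN : ∀ {k} → (L ⊔ L′) ⊔ (M ⊔ N) ℕ.≤ k → M ⊔ N ℕ.≤ k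
        hMN = ℕ.m⊔n≤o⇒n≤o (L ⊔ L′) (M ⊔ N)

  *-cauchy : ∀ {a b} → IsCauchy a → IsCauchy b → IsCauchy (λ n → a n ℚ.* b n)
  *-cauchy {a} {b} ca cb = *-cauchy′ {a} {b} (bounded ca) (bounded cb) ca cb

infixl 6 _+_ _-_
infixl 7 _*_
infix  8 -_

fromℚ : ℚ → ℝ
fromℚ q = mkℝ (λ _ → q) (const-cauchy q)

0ℝ 1ℝ : ℝ
0ℝ = fromℚ 0ℚ
1ℝ = fromℚ 1ℚ

_+_ : ℝ → ℝ → ℝ
x + y = mkℝ (λ n → seq x n ℚ.+ seq y n) (+-cauchy {seq x} {seq y} (cauchy x) (cauchy y))

_*_ : ℝ → ℝ → ℝ
x * y = mkℝ (λ n → seq x n ℚ.* seq y n) (*-cauchy {seq x} {seq y} (cauchy x) (cauchy y))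

-_ : ℝ → ℝ
- x = mkℝ (λ n → ℚ.- seq x n) (neg-cauchy {seq x} (cauchy x))

_-_ : ℝ → ℝ → ℝ
x - y = x + (- y)

+-0-rawMonoid : RawMonoid _ _
+-0-rawMonoid = record { Carrier = ℝ ; _≈_ = _≈_ ; _∙_ = _+_ ; ε = 0ℝ }

∑ℝ : ∀ {n} → Vector ℝ n → ℝ
∑ℝ = RawMonoidSum.sum +-0-rawMonoid

∑ : ∀ {n} → Vector ℕ n → ℕ
∑ = RawMonoidSum.sum ℕ.+-0-rawMonoid

ι : ℕ → ℚ
ι k = + k / 1

-- Finite cardinality of a (not necessarily decidable) predicate: exactly k
-- elements satisfy P.

Exactly : ∀ {ℓ} {A : Set} → ℕ → (A → Set ℓ) → Set ℓ
Exactly {A = A} k P =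
  Σ[ xs ∈ List A ] (Unique xs × length xs ≡ k × (∀ a → a ∈ xs ⇔ P a))

data BoxConstraint (n : ℕ) : Set where
  lower upper : Fin n → BoxConstraint n

data Constraint (n : ℕ) : Set where
  box                 : BoxConstraint n → Constraint n
  knapsackˢ knapsackᵈ : Constraint n

module Polytope (m : ℕ) (s : Vector ℕ (2 ℕ.* m)) where

  Point : Set
  Point = Vector ℝ (2 ℕ.* m)

  S s-max M : ℕ
  S     = ∑ s
  s-max = foldr _⊔_ 0 s
  M     = suc S

  -- The truncated subtraction is exact, since every s i is at most s-max.
  d : Vector ℕ (2 ℕ.* m)
  d i = s-max ∸ s i

  ε : ℚ
  ε = + 1 / (2 ℕ.* M)

  weight : Vector ℕ (2 ℕ.* m) → Point → ℝ
  weight c x = ∑ℝ λ i → fromℚ (ι (M ℕ.+ c i)) * x i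

  capacity : Vector ℕ (2 ℕ.* m) → ℝ
  capacity c = fromℚ (½ ℚ.* ι (∑ c) ℚ.+ ι m ℚ.* ι M ℚ.+ ε)

  lhs rhs : Constraint (2 ℕ.* m) → Point → ℝ
  lhs (box (lower i)) x = 0ℝ
  lhs (box (upper i)) x = x i
  lhs knapsackˢ       x = weight s x
  lhs knapsackᵈ       x = weight d x
  rhs (box (lower i)) x = x i
  rhs (box (upper i)) x = 1ℝ
  rhs knapsackˢ       x = capacity s
  rhs knapsackᵈ       x = capacity d

  Pᴿ : Point → Set
  Pᴿ x = ∀ c → lhs c x ≤ rhs c x

  Active : Point → Constraint (2 ℕ.* m) → Set
  Active x c = lhs c x ≈ rhs c x

  -- Vertices are extreme points.
  IsVertex : Point → Set
  IsVertex v = Pᴿ v ×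
    (∀ x y t → Pᴿ x → Pᴿ y → 0ℝ < t → t < 1ℝ →
      (∀ i → v i ≈ (1ℝ - t) * x i + t * y i) →
      ∀ i → x i ≈ y i)

  IsDegenerate : Point → Set
  IsDegenerate v = ∃[ k ] (2 ℕ.* m ℕ.< k × Exactly k (Active v))

{-# OPTIONS --safe #-}
module Submission where

-- Write w = M + sᵢ and b = ε / w. Since sᵢ = s-max / 2 gives dᵢ = sᵢ, and the
-- partition of s is also one of d, both knapsack inequalities at v say
-- w vᵢ ≤ ε, that is vᵢ ≤ b. If vᵢ < b, then v = (1 - t) point 0 + t point b
-- with t = vᵢ / b, where point x is v with its i-th coordinate replaced by x;
-- both ends are feasible, contradicting extremality. For Cauchy reals
-- vᵢ ≤ b and ¬ vᵢ < b already give vᵢ ≈ b, so no classical logic is needed.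

open import Defs
import Algebra.Properties.Monoid.Sum
open import Data.Empty using (⊥)
open import Data.Fin.Base as Fin using (Fin; zero; suc; toℕ; _↑ˡ_; _↑ʳ_; reduce≥)
import Data.Fin.Properties as Fin
open import Data.Integer.Base as ℤ using (+_)
import Data.Integer.Properties as ℤ
open import Data.List.Base as List using (List; []; _∷_; length; map)
open import Data.List.Membership.Propositional using (_∈_; _∉_)
open import Data.List.Membership.Propositional.Properties using (∈-map⁺; ∈-map⁻; ∈-lookup)
open import Data.List.Properties using (length-map)
open import Data.List.Relation.Unary.All as All using (All; []; _∷_)
open import Data.List.Relation.Unary.All.Properties using (¬Any⇒All¬)
open import Data.List.Relation.Unary.AllPairs using ([]; _∷_)
open import Data.List.Relation.Unary.Any using (here; there; any?)
open import Data.List.Relation.Unary.Unique.Propositional using (Unique)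
import Data.List.Relation.Unary.Unique.Propositional.Properties as Unique
open import Data.Nat.Base as ℕ using (ℕ; zero; suc; _∸_; _⊔_; s≤s; z≤n)
import Data.Nat.Coprimality as Coprime
import Data.Nat.Properties as ℕ
import Data.Nat.Tactic.RingSolver as ℕ
open import Data.Product.Base using (_×_; _,_; ∃-syntax; proj₁)
open import Data.Rational.Base as ℚ using (ℚ; mkℚ; 0ℚ; 1ℚ; ½; ∣_∣; _/_; 1/_; *≤*)
import Data.Rational.Properties as ℚ
open import Data.Rational.Solver using (module +-*-Solver)
import Data.Rational.Unnormalised.Base as ℚᵘ
import Data.Rational.Unnormalised.Properties as ℚᵘ
open import Data.Sum.Base using (_⊎_; inj₁; inj₂; [_,_]′; fromInj₁)
open import Data.Vec.Functional using (Vector; take; drop; foldr)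
open import Function.Base using (_∘_; id)
open import Function.Bundles using (_⇔_; mk⇔; Equivalence)
open import Relation.Binary.PropositionalEquality
  using (_≡_; _≢_; refl; sym; trans; cong; cong₂; subst; subst₂; module ≡-Reasoning)
open import Relation.Nullary.Decidable using (yes; no)
open import Relation.Nullary.Negation using (¬_; contradiction)

private module Σℚ = Algebra.Properties.Monoid.Sum ℚ.+-0-monoid

open +-*-Solver

-- Inequalities and absolute values of rationals.

∑ℚ : ∀ {n} → Vector ℚ n → ℚ
∑ℚ = Σℚ.sum

-- The hypothesis is s - r = q - p without subtractions; it lets the ring solver
-- discharge linear arithmetic.
≤-from : ∀ {p q} r s → p ℚ.≤ q → r ℚ.+ q ≡ s ℚ.+ p → r ℚ.≤ s
≤-from {p} {q} r s p≤q eq = begin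
  r                          ≡⟨ solve 2 (λ r q → r := (r :+ q) :- q) refl r q ⟩
  (r ℚ.+ q) ℚ.- q            ≡⟨ cong (ℚ._- q) eq ⟩
  (s ℚ.+ p) ℚ.- q            ≤⟨ ℚ.+-monoˡ-≤ (ℚ.- q) (ℚ.+-monoʳ-≤ s p≤q) ⟩
  (s ℚ.+ q) ℚ.- q            ≡⟨ solve 2 (λ s q → (s :+ q) :- q := s) refl s q ⟩
  s                          ∎
  where open ℚ.≤-Reasoning

p≤∣p∣ : ∀ p → p ℚ.≤ ∣ p ∣
p≤∣p∣ p with ℚ.∣p∣≡p∨∣p∣≡-p p
... | inj₁ eq = ℚ.≤-reflexive (sym eq)
-- Here `∣ p ∣ ≡ - p`, so the difference `∣ p ∣ - p` equals `∣ p ∣ + ∣ p ∣`, which is nonnegative.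
... | inj₂ eq = ≤-from p ∣ p ∣
  (ℚ.+-mono-≤ (ℚ.0≤∣p∣ p) (ℚ.0≤∣p∣ p))
  (trans (cong₂ (λ x y → p ℚ.+ (x ℚ.+ y)) eq eq)
    (trans (solve 1 (λ p → p :+ (:- p :+ :- p) := :- p :+ con 0ℚ) refl p)
      (cong (ℚ._+ 0ℚ) (sym eq))))

∣-∣-comm : ∀ p q → ∣ p ℚ.- q ∣ ≡ ∣ q ℚ.- p ∣
∣-∣-comm p q = trans
  (cong ∣_∣ (solve 2 (λ p q → p :- q := :- (q :- p)) refl p q)) (ℚ.∣-p∣≡∣p∣ (q ℚ.- p))

∣p-q∣≤r⇒p≤q+r : ∀ p q {r} → ∣ p ℚ.- q ∣ ℚ.≤ r → p ℚ.≤ q ℚ.+ r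
∣p-q∣≤r⇒p≤q+r p q {r} h = ≤-from p (q ℚ.+ r) (ℚ.≤-trans (p≤∣p∣ (p ℚ.- q)) h)
  (solve 3 (λ p q r → p :+ r := q :+ r :+ (p :- q)) refl p q r)

p≤q+r∧q≤p+r⇒∣p-q∣≤r : ∀ p q r → p ℚ.≤ q ℚ.+ r → q ℚ.≤ p ℚ.+ r → ∣ p ℚ.- q ∣ ℚ.≤ r
p≤q+r∧q≤p+r⇒∣p-q∣≤r p q r h k with ℚ.∣p∣≡p∨∣p∣≡-p (p ℚ.- q)
... | inj₁ eq = subst (ℚ._≤ r) (sym eq)
  (≤-from (p ℚ.- q) r h (solve 3 (λ p q r → p :- q :+ (q :+ r) := r :+ p) refl p q r))
... | inj₂ eq = subst (ℚ._≤ r) (sym eq)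
  (≤-from (ℚ.- (p ℚ.- q)) r k
    (solve 3 (λ p q r → :- (p :- q) :+ (p :+ r) := r :+ q) refl p q r))

half-pos : ∀ {p} → 0ℚ ℚ.< p → 0ℚ ℚ.< ½ ℚ.* p
half-pos = ℚ.*-monoʳ-<-pos ½

≤-half⇒⊥ : ∀ {p} → 0ℚ ℚ.< p → ¬ p ℚ.≤ ½ ℚ.* p
≤-half⇒⊥ {p} 0<p h = ℚ.<-irrefl refl (ℚ.<-≤-trans (half-pos 0<p)
  (≤-from (½ ℚ.* p) 0ℚ h (solve 1 (λ p → con ½ :* p :+ con ½ :* p := con 0ℚ :+ p) refl p)))

-- Equality and order of Cauchy reals.

eventually-∧ : ∀ {P Q R : ℕ → Set} → (∀ n → P n → Q n → R n) →
  Eventually P → Eventually Q → Eventually R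
eventually-∧ f (L , p) (N , q) =
  L ⊔ N , λ n h → f n (p n (ℕ.m⊔n≤o⇒m≤o L N h)) (q n (ℕ.m⊔n≤o⇒n≤o L N h))

eventually-map : ∀ {P Q : ℕ → Set} → (∀ n → P n → Q n) → Eventually P → Eventually Q
eventually-map f (N , p) = N , λ n h → f n (p n h)

¬eventually-⊥ : ¬ Eventually (λ _ → ⊥)
¬eventually-⊥ (N , p) = p N ℕ.≤-refl

pointwise⇒≤ : ∀ x y → (∀ n → seq x n ℚ.≤ seq y n) → x ≤ y
pointwise⇒≤ x y h ε 0<ε = 0 , λ n _ → ℚ.≤-trans (h n)
  (≤-from (seq y n) (seq y n ℚ.+ ε) (ℚ.<⇒≤ 0<ε)
    (solve 2 (λ y e → y :+ e := y :+ e :+ con 0ℚ) refl (seq y n) ε))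

pointwise⇒≈ : ∀ x y → (∀ n → seq x n ≡ seq y n) → x ≈ y
pointwise⇒≈ x y h ε 0<ε = 0 , λ n _ → subst (λ p → ∣ p ℚ.- seq y n ∣ ℚ.≤ ε) (sym (h n))
  (subst (λ p → ∣ p ∣ ℚ.≤ ε) (sym (ℚ.+-inverseʳ (seq y n))) (ℚ.<⇒≤ 0<ε))

≈-refl : ∀ x → x ≈ x
≈-refl x = pointwise⇒≈ x x λ _ → refl

≈-sym : ∀ x y → x ≈ y → y ≈ x
≈-sym x y h ε 0<ε =
  eventually-map (λ n → subst (ℚ._≤ ε) (∣-∣-comm (seq x n) (seq y n))) (h ε 0<ε)

≈-trans : ∀ x y z → x ≈ y → y ≈ z → x ≈ z
≈-trans x y z h k ε 0<ε = eventually-∧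
  (λ n p q → begin
    ∣ seq x n ℚ.- seq z n ∣
      ≡⟨ cong ∣_∣ (solve 3 (λ x y z → x :- z := (x :- y) :+ (y :- z)) refl
           (seq x n) (seq y n) (seq z n)) ⟩
    ∣ (seq x n ℚ.- seq y n) ℚ.+ (seq y n ℚ.- seq z n) ∣
      ≤⟨ ℚ.∣p+q∣≤∣p∣+∣q∣ (seq x n ℚ.- seq y n) (seq y n ℚ.- seq z n) ⟩
    ∣ seq x n ℚ.- seq y n ∣ ℚ.+ ∣ seq y n ℚ.- seq z n ∣
      ≤⟨ ℚ.+-mono-≤ p q ⟩
    ½ ℚ.* ε ℚ.+ ½ ℚ.* ε
      ≡⟨ solve 1 (λ e → con ½ :* e :+ con ½ :* e := e) refl ε ⟩
    ε ∎)
  (h (½ ℚ.* ε) (half-pos 0<ε)) (k (½ ℚ.* ε) (half-pos 0<ε))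
  where open ℚ.≤-Reasoning

+-cong : ∀ w x y z → w ≈ x → y ≈ z → w + y ≈ x + z
+-cong w x y z h k ε 0<ε = eventually-∧
  (λ n p q → begin
    ∣ (seq w n ℚ.+ seq y n) ℚ.- (seq x n ℚ.+ seq z n) ∣
      ≡⟨ cong ∣_∣ (solve 4 (λ w x y z → (w :+ y) :- (x :+ z) := (w :- x) :+ (y :- z)) refl
           (seq w n) (seq x n) (seq y n) (seq z n)) ⟩
    ∣ (seq w n ℚ.- seq x n) ℚ.+ (seq y n ℚ.- seq z n) ∣
      ≤⟨ ℚ.∣p+q∣≤∣p∣+∣q∣ (seq w n ℚ.- seq x n) (seq y n ℚ.- seq z n) ⟩
    ∣ seq w n ℚ.- seq x n ∣ ℚ.+ ∣ seq y n ℚ.- seq z n ∣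
      ≤⟨ ℚ.+-mono-≤ p q ⟩
    ½ ℚ.* ε ℚ.+ ½ ℚ.* ε
      ≡⟨ solve 1 (λ e → con ½ :* e :+ con ½ :* e := e) refl ε ⟩
    ε ∎)
  (h (½ ℚ.* ε) (half-pos 0<ε)) (k (½ ℚ.* ε) (half-pos 0<ε))
  where open ℚ.≤-Reasoning

module _ (p : ℚ) .{{p-pos : ℚ.Positive p}} where

  private instance
    p-nonZero : ℚ.NonZero p
    p-nonZero = ℚ.pos⇒nonZero p

    p-nonNeg : ℚ.NonNegative p
    p-nonNeg = ℚ.pos⇒nonNeg p

    1/p-pos : ℚ.Positive (1/ p)
    1/p-pos = ℚ.1/pos⇒pos p

  quotient-pos : ∀ {q} → 0ℚ ℚ.< q → 0ℚ ℚ.< 1/ p ℚ.* q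
  quotient-pos {q} 0<q =
    subst (ℚ._< 1/ p ℚ.* q) (ℚ.*-zeroʳ (1/ p)) (ℚ.*-monoʳ-<-pos (1/ p) 0<q)

  *-quotient : ∀ q → p ℚ.* (1/ p ℚ.* q) ≡ q
  *-quotient q = trans (sym (ℚ.*-assoc p (1/ p) q))
    (trans (cong (ℚ._* q) (ℚ.*-inverseʳ p)) (ℚ.*-identityˡ q))

  *-congˡ : ∀ x y → x ≈ y → fromℚ p * x ≈ fromℚ p * y
  *-congˡ x y h ε 0<ε = eventually-map
    (λ n k → begin
      ∣ p ℚ.* seq x n ℚ.- p ℚ.* seq y n ∣
        ≡⟨ cong ∣_∣ (solve 3 (λ p x y → p :* x :- p :* y := p :* (x :- y)) refl
             p (seq x n) (seq y n)) ⟩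
      ∣ p ℚ.* (seq x n ℚ.- seq y n) ∣
        ≡⟨ ℚ.∣p*q∣≡∣p∣*∣q∣ p (seq x n ℚ.- seq y n) ⟩
      ∣ p ∣ ℚ.* ∣ seq x n ℚ.- seq y n ∣
        ≡⟨ cong (ℚ._* ∣ seq x n ℚ.- seq y n ∣) (ℚ.0≤p⇒∣p∣≡p (ℚ.nonNegative⁻¹ p)) ⟩
      p ℚ.* ∣ seq x n ℚ.- seq y n ∣
        ≤⟨ ℚ.*-monoˡ-≤-nonNeg p k ⟩
      p ℚ.* (1/ p ℚ.* ε)
        ≡⟨ *-quotient ε ⟩
      ε ∎)
    (h (1/ p ℚ.* ε) (quotient-pos 0<ε))
    where open ℚ.≤-Reasoning

  *-cancelˡ-≤ : ∀ x y → fromℚ p * x ≤ fromℚ p * y → x ≤ y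
  *-cancelˡ-≤ x y h ε 0<ε = eventually-map
    (λ n k → ℚ.*-cancelˡ-≤-pos p
      (subst (p ℚ.* seq x n ℚ.≤_) (sym (ℚ.*-distribˡ-+ p (seq y n) ε)) k))
    (h (p ℚ.* ε) (subst (ℚ._< p ℚ.* ε) (ℚ.*-zeroʳ p) (ℚ.*-monoʳ-<-pos p 0<ε)))

  *-monoˡ-< : ∀ x y → x < y → fromℚ p * x < fromℚ p * y
  *-monoˡ-< x y (ε , 0<ε , h) = p ℚ.* ε ,
    subst (ℚ._< p ℚ.* ε) (ℚ.*-zeroʳ p) (ℚ.*-monoʳ-<-pos p 0<ε) ,
    eventually-map (λ n k → subst (ℚ._≤ p ℚ.* seq y n) (ℚ.*-distribˡ-+ p (seq x n) ε)
      (ℚ.*-monoˡ-≤-nonNeg p k)) h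

<-resp-pointwise : ∀ w x y z → (∀ n → seq w n ≡ seq x n) → (∀ n → seq y n ≡ seq z n) →
  w < y → x < z
<-resp-pointwise w x y z h k (ε , 0<ε , l) =
  ε , 0<ε , eventually-map (λ n → subst₂ (λ p q → p ℚ.+ ε ℚ.≤ q) (h n) (k n)) l

+-cancelˡ-≤ : ∀ x y z → x + y ≤ x + z → y ≤ z
+-cancelˡ-≤ x y z h ε 0<ε = eventually-map
  (λ n k → ≤-from (seq y n) (seq z n ℚ.+ ε) k
    (solve 4 (λ x y z e → y :+ (x :+ z :+ e) := z :+ e :+ (x :+ y)) refl
      (seq x n) (seq y n) (seq z n) ε))
  (h ε 0<ε)

≤-respˡ-≈ : ∀ x y z → x ≈ y → x ≤ z → y ≤ z
≤-respˡ-≈ x y z h k ε 0<ε = eventually-∧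
  (λ n p q → ≤-from (seq y n) (seq z n ℚ.+ ε)
    (ℚ.+-mono-≤ (∣p-q∣≤r⇒p≤q+r (seq y n) (seq x n)
      (subst (ℚ._≤ ½ ℚ.* ε) (∣-∣-comm (seq x n) (seq y n)) p)) q)
    (solve 4 (λ x y z e → y :+ (x :+ con ½ :* e :+ (z :+ con ½ :* e)) := z :+ e :+ (y :+ x))
      refl (seq x n) (seq y n) (seq z n) ε))
  (h (½ ℚ.* ε) (half-pos 0<ε)) (k (½ ℚ.* ε) (half-pos 0<ε))

-- A gap of `ε` together with closeness within `½ * ε` at a common index would give `ε ≤ ½ * ε`.
<⇒≉ : ∀ x y → x < y → ¬ x ≈ y
<⇒≉ x y (ε , 0<ε , h) k = ¬eventually-⊥ (eventually-∧
  (λ n p q → ≤-half⇒⊥ 0<ε (≤-from ε (½ ℚ.* ε)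
    (ℚ.+-mono-≤ p (∣p-q∣≤r⇒p≤q+r (seq y n) (seq x n)
      (subst (ℚ._≤ ½ ℚ.* ε) (∣-∣-comm (seq x n) (seq y n)) q)))
    (solve 3 (λ x y e → e :+ (y :+ (x :+ con ½ :* e)) := con ½ :* e :+ (x :+ e :+ y))
      refl (seq x n) (seq y n) ε)))
  h (k (½ ℚ.* ε) (half-pos 0<ε)))

fromℚ-mono-< : ∀ {p q} → p ℚ.< q → fromℚ p < fromℚ q
fromℚ-mono-< {p} {q} p<q = q ℚ.- p ,
  subst (ℚ._< q ℚ.- p) (ℚ.+-inverseʳ p) (ℚ.+-monoˡ-< (ℚ.- p) p<q) ,
  0 , λ _ _ → ℚ.≤-reflexive (solve 2 (λ p q → p :+ (q :- p) := q) refl p q)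

0≉1 : ¬ 0ℝ ≈ 1ℝ
0≉1 = <⇒≉ 0ℝ 1ℝ (fromℚ-mono-< (ℚ.positive⁻¹ 1ℚ))

-- Past a Cauchy index `N` the sequence stays within `γ` of the rational `seq x N`, and comparing
-- `seq x N + δ` with `q` is decidable. If it is at most `q`, the whole tail lies below `q` by `γ`,
-- so `x < fromℚ q`; if not, the tail cannot fall below `q` by more than `ε`.
≤∧≮⇒≈ : ∀ x q → x ≤ fromℚ q → ¬ x < fromℚ q → x ≈ fromℚ q
≤∧≮⇒≈ x q x≤q x≮q ε 0<ε = go (cauchy x γ 0<γ)
  where
  δ γ : ℚ
  δ = ½ ℚ.* ε
  γ = ½ ℚ.* δ

  0<γ : 0ℚ ℚ.< γ
  0<γ = half-pos (half-pos 0<ε)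

  go : (∃[ N ] ∀ k l → N ℕ.≤ k → N ℕ.≤ l → ∣ seq x k ℚ.- seq x l ∣ ℚ.≤ γ) →
       Eventually λ n → ∣ seq x n ℚ.- q ∣ ℚ.≤ ε
  go (N , close) with seq x N ℚ.+ δ ℚ.≤? q
  ... | yes h = contradiction
    (γ , 0<γ , N , λ n N≤n → ≤-from (seq x n ℚ.+ γ) q
      (ℚ.+-mono-≤ (∣p-q∣≤r⇒p≤q+r (seq x n) (seq x N) (close n N N≤n ℕ.≤-refl)) h)
      (solve 4 (λ x r e q → x :+ con ½ :* e :+ (r :+ con ½ :* e :+ q) := q :+ (x :+ (r :+ e)))
        refl (seq x n) (seq x N) δ q))
    x≮q
  -- The bounds `q < seq x N + δ` and `seq x N ≤ seq x n + γ` lose only three quarters of `ε`; the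
  -- summand `0 < γ` pads this to `ε`.
  ... | no h = eventually-∧
    (λ n N≤n x≤ → p≤q+r∧q≤p+r⇒∣p-q∣≤r (seq x n) q ε x≤
      (≤-from q (seq x n ℚ.+ ε)
        (ℚ.+-mono-≤ (ℚ.<⇒≤ (half-pos (half-pos 0<ε)))
          (ℚ.+-mono-≤ (ℚ.<⇒≤ (ℚ.≰⇒> h))
            (∣p-q∣≤r⇒p≤q+r (seq x N) (seq x n) (close N n ℕ.≤-refl N≤n))))
        (solve 4 (λ x r e q →
            q :+ (con ½ :* (con ½ :* e) :+ (r :+ con ½ :* e :+ (x :+ con ½ :* (con ½ :* e))))
            := x :+ e :+ (con 0ℚ :+ (q :+ r)))
          refl (seq x n) (seq x N) ε q)))
    (N , λ n h → h) (x≤q ε 0<ε)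

-- Natural numbers inside the rationals.

-- The division in `ι k` normalises by a gcd that does not reduce for a variable `k`; in this form
-- the numerator can be read off and the operations compute.
ι≡mkℚ : ∀ k → ι k ≡ mkℚ (+ k) 0 (Coprime.sym (Coprime.1-coprimeTo k))
ι≡mkℚ k = ℚ.normalize-coprime (Coprime.sym (Coprime.1-coprimeTo k))

ι-injective : ∀ {k l} → ι k ≡ ι l → k ≡ l
ι-injective {k} {l} eq =
  ℤ.+-injective (cong ℚ.numerator (trans (sym (ι≡mkℚ k)) (trans eq (ι≡mkℚ l))))

ι-+ : ∀ k l → ι (k ℕ.+ l) ≡ ι k ℚ.+ ι l
ι-+ k l = sym (trans (cong₂ ℚ._+_ (ι≡mkℚ k) (ι≡mkℚ l))
  (ℚ./-cong {q₁ = 1} {q₂ = 1}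
    (cong₂ ℤ._+_ (ℤ.*-identityʳ (+ k)) (ℤ.*-identityʳ (+ l))) refl))

ι-mono-≤ : ∀ k l → k ℕ.≤ l → ι k ℚ.≤ ι l
ι-mono-≤ k l h = subst₂ ℚ._≤_ (sym (ι≡mkℚ k)) (sym (ι≡mkℚ l))
  (*≤* (ℤ.*-monoʳ-≤-nonNeg (+ 1) (ℤ.+≤+ h)))

ι-suc-pos : ∀ k → ℚ.Positive (ι (suc k))
ι-suc-pos k = ℚ.normalize-pos (suc k) 1

1/suc≤1 : ∀ k → + 1 / suc k ℚ.≤ 1ℚ
1/suc≤1 k = ℚ.toℚᵘ-cancel-≤ (ℚᵘ.≤-respˡ-≃
  (ℚᵘ.≃-sym (ℚ.toℚᵘ-fromℚᵘ (ℚᵘ.mkℚᵘ (+ 1) k)))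
  (ℚᵘ.*≤* (ℤ.+≤+ (s≤s z≤n))))

-- Turns the rational hypotheses about `½ * ι S` and `½ * ι s-max` into equations of naturals free
-- of division.
ι-half⇒double : ∀ k l → ι k ≡ ½ ℚ.* ι l → l ≡ k ℕ.+ k
ι-half⇒double k l eq = ι-injective (begin
  ι l                        ≡⟨ solve 1 (λ q → q := con ½ :* q :+ con ½ :* q) refl (ι l) ⟩
  ½ ℚ.* ι l ℚ.+ ½ ℚ.* ι l    ≡⟨ cong₂ ℚ._+_ eq eq ⟨
  ι k ℚ.+ ι k                ≡⟨ ι-+ k k ⟨
  ι (k ℕ.+ k)                ∎)
  where open ≡-Reasoning

ι-half : ∀ k → ι k ≡ ½ ℚ.* ι (k ℕ.+ k)
ι-half k = begin
  ι k                        ≡⟨ solve 1 (λ q → q := con ½ :* (q :+ q)) refl (ι k) ⟩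
  ½ ℚ.* (ι k ℚ.+ ι k)        ≡⟨ cong (½ ℚ.*_) (ι-+ k k) ⟨
  ½ ℚ.* ι (k ℕ.+ k)          ∎
  where open ≡-Reasoning

-- Finite sums.

seq-∑ℝ : ∀ {n} (f : Vector ℝ n) k → seq (∑ℝ f) k ≡ ∑ℚ λ j → seq (f j) k
seq-∑ℝ {zero}  f k = refl
seq-∑ℝ {suc n} f k = cong (seq (f zero) k ℚ.+_) (seq-∑ℝ (f ∘ suc) k)

∑ℝ-cong : ∀ {n} (f g : Vector ℝ n) → (∀ j → f j ≈ g j) → ∑ℝ f ≈ ∑ℝ g
∑ℝ-cong {zero}  f g h = ≈-refl 0ℝ
∑ℝ-cong {suc n} f g h = +-cong (f zero) (g zero) (∑ℝ (f ∘ suc)) (∑ℝ (g ∘ suc))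
  (h zero) (∑ℝ-cong (f ∘ suc) (g ∘ suc) (h ∘ suc))

∑ℚ-split : ∀ m {n} (f : Vector ℚ (m ℕ.+ n)) → ∑ℚ f ≡ ∑ℚ (take m f) ℚ.+ ∑ℚ (drop m f)
∑ℚ-split zero    f = sym (ℚ.+-identityˡ (∑ℚ f))
∑ℚ-split (suc m) f = trans (cong (f zero ℚ.+_) (∑ℚ-split m (f ∘ suc)))
  (sym (ℚ.+-assoc (f zero) (∑ℚ (take m (f ∘ suc))) (∑ℚ (drop m (f ∘ suc)))))

∑ℚ-zero : ∀ {n} (f : Vector ℚ n) → (∀ j → f j ≡ 0ℚ) → ∑ℚ f ≡ 0ℚ
∑ℚ-zero {n} f h = trans (Σℚ.sum-cong-≗ h) (Σℚ.sum-replicate-zero n)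

∑ℚ-single : ∀ {n} (f : Vector ℚ n) i → (∀ j → j ≢ i → f j ≡ 0ℚ) → ∑ℚ f ≡ f i
∑ℚ-single f zero    h =
  trans (cong (f zero ℚ.+_) (∑ℚ-zero (f ∘ suc) λ j → h (suc j) λ ())) (ℚ.+-identityʳ (f zero))
∑ℚ-single f (suc i) h = trans
  (cong₂ ℚ._+_ (h zero λ ()) (∑ℚ-single (f ∘ suc) i λ j j≢i → h (suc j) (j≢i ∘ Fin.suc-injective)))
  (ℚ.+-identityˡ (f (suc i)))

∑ℚ-ι-shift : ∀ {n} k (c : Vector ℕ n) →
  ∑ℚ (λ j → ι (k ℕ.+ c j)) ≡ ι (∑ c) ℚ.+ ι n ℚ.* ι k
∑ℚ-ι-shift {zero}  k c = sym (trans (ℚ.+-identityˡ (0ℚ ℚ.* ι k)) (ℚ.*-zeroˡ (ι k)))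
∑ℚ-ι-shift {suc n} k c = begin
  ι (k ℕ.+ c zero) ℚ.+ ∑ℚ (λ j → ι (k ℕ.+ c (suc j)))
    ≡⟨ cong₂ ℚ._+_ (ι-+ k (c zero)) (∑ℚ-ι-shift k (c ∘ suc)) ⟩
  (ι k ℚ.+ ι (c zero)) ℚ.+ (ι (∑ (c ∘ suc)) ℚ.+ ι n ℚ.* ι k)
    ≡⟨ solve 4 (λ k a b n → (k :+ a) :+ (b :+ n :* k) := (a :+ b) :+ (con 1ℚ :+ n) :* k) refl
         (ι k) (ι (c zero)) (ι (∑ (c ∘ suc))) (ι n) ⟩
  (ι (c zero) ℚ.+ ι (∑ (c ∘ suc))) ℚ.+ (1ℚ ℚ.+ ι n) ℚ.* ι k
    ≡⟨ cong₂ (λ p q → p ℚ.+ q ℚ.* ι k) (ι-+ (c zero) (∑ (c ∘ suc))) (ι-+ 1 n) ⟨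
  ι (∑ c) ℚ.+ ι (suc n) ℚ.* ι k ∎
  where open ≡-Reasoning

-- Written with addition so that each truncated subtraction, exact by the bound, cancels termwise.
-- It serves both for all coordinates and for the first `m`.
∑-complement : ∀ {n} k (c : Vector ℕ n) → (∀ j → c j ℕ.≤ k) →
  ∑ (λ j → k ∸ c j) ℕ.+ ∑ c ≡ n ℕ.* k
∑-complement {zero}  k c h = refl
∑-complement {suc n} k c h = trans
  (interchange (k ∸ c zero) (∑ λ j → k ∸ c (suc j)) (c zero) (∑ (c ∘ suc)))
  (cong₂ ℕ._+_ (ℕ.m∸n+n≡m (h zero)) (∑-complement k (c ∘ suc) (h ∘ suc)))
  where
  interchange : ∀ a b c d → (a ℕ.+ b) ℕ.+ (c ℕ.+ d) ≡ (a ℕ.+ c) ℕ.+ (b ℕ.+ d)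
  interchange = ℕ.solve-∀

≤-max : ∀ {n} (c : Vector ℕ n) j → c j ℕ.≤ foldr _⊔_ 0 c
≤-max c zero    = ℕ.m≤m⊔n (c zero) (foldr _⊔_ 0 (c ∘ suc))
≤-max c (suc j) = ℕ.≤-trans (≤-max (c ∘ suc) j) (ℕ.m≤n⊔m (c zero) (foldr _⊔_ 0 (c ∘ suc)))

-- Counting in duplicate-free lists.

lookup-injective : ∀ {A : Set} {xs : List A} → Unique xs →
  ∀ {k l} → List.lookup xs k ≡ List.lookup xs l → k ≡ l
lookup-injective (_ ∷ _)  {zero}  {zero}  _  = refl
lookup-injective (h ∷ _)  {zero}  {suc l} eq = contradiction eq (All.lookup h (∈-lookup l))
lookup-injective (h ∷ _)  {suc k} {zero}  eq = contradiction (sym eq) (All.lookup h (∈-lookup k))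
lookup-injective (_ ∷ u)  {suc k} {suc l} eq = cong suc (lookup-injective u eq)

-- Pigeonhole: looking up positions injects `Fin (length xs)` into `Fin n`.
unique⇒length≤ : ∀ {n} {xs : List (Fin n)} → Unique xs → length xs ℕ.≤ n
unique⇒length≤ u = Fin.injective⇒≤ (lookup-injective u)

∉⇒All≢ : ∀ {A : Set} {x : A} {xs} → x ∉ xs → All (x ≢_) xs
∉⇒All≢ = ¬Any⇒All¬ _

-- If `j` were missing as well, prepending `i` and `j` would give a duplicate-free list with more
-- entries than `Fin n` has elements.
only-one-missing : ∀ {n} {xs : List (Fin n)} {i j} → Unique xs → length xs ≡ n ∸ 1 →
  i ∉ xs → j ≢ i → j ∈ xs
only-one-missing {suc n} {xs} {i} {j} u len i∉xs j≢i with any? (j Fin.≟_) xs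
... | yes j∈xs = j∈xs
... | no  j∉xs = contradiction
  (subst (λ k → suc (suc k) ℕ.≤ suc n) len
    (unique⇒length≤ ((j≢i ∷ ∉⇒All≢ j∉xs) ∷ ∉⇒All≢ i∉xs ∷ u)))
  ℕ.1+n≰n

-- Points with one free coordinate.

-- Generic in the entries, so that rational and real points share one case analysis. The test
-- against `m` comes first, so `x` is placed only when `i` lies in the second half.
template : ∀ {A : Set} {n} → A → A → ℕ → Fin n → A → Fin n → A
template o e m i x j with toℕ j ℕ.<? m | j Fin.≟ i
... | yes _ | _     = e
... | no  _ | yes _ = x
... | no  _ | no  _ = o

module _ {A : Set} {n} (o e : A) (m : ℕ) (i : Fin n) (x : A) where

  template-< : ∀ j → toℕ j ℕ.< m → template o e m i x j ≡ e
  template-< j j<m with toℕ j ℕ.<? m | j Fin.≟ i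
  ... | yes _   | _ = refl
  ... | no j≮m | _ = contradiction j<m j≮m

  template-≡ : m ℕ.≤ toℕ i → template o e m i x i ≡ x
  template-≡ m≤i with toℕ i ℕ.<? m | i Fin.≟ i
  ... | yes i<m | _       = contradiction m≤i (ℕ.<⇒≱ i<m)
  ... | no _    | yes _   = refl
  ... | no _    | no i≢i = contradiction refl i≢i

  template-≢ : ∀ j → m ℕ.≤ toℕ j → j ≢ i → template o e m i x j ≡ o
  template-≢ j m≤j j≢i with toℕ j ℕ.<? m | j Fin.≟ i
  ... | yes j<m | _       = contradiction m≤j (ℕ.<⇒≱ j<m)
  ... | no _    | yes j≡i = contradiction j≡i j≢i
  ... | no _    | no _    = refl

  template-elim : (P : Fin n → A → Set) → (∀ j → toℕ j ℕ.< m → P j e) → P i x →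
    (∀ j → m ℕ.≤ toℕ j → j ≢ i → P j o) → ∀ j → P j (template o e m i x j)
  template-elim P pe px po j with toℕ j ℕ.<? m | j Fin.≟ i
  ... | yes j<m | _        = pe j j<m
  ... | no  _   | yes refl = px
  ... | no  j≮m | no  j≢i  = po j (ℕ.≮⇒≥ j≮m) j≢i

pointℚ : ∀ {n} → ℕ → Fin n → ℚ → Vector ℚ n
pointℚ = template 0ℚ 1ℚ

pointℝ : ∀ {n} → ℕ → Fin n → ℝ → Vector ℝ n
pointℝ = template 0ℝ 1ℝ

seq-pointℝ : ∀ {n} m (i : Fin n) x k j → seq (pointℝ m i x j) k ≡ pointℚ m i (seq x k) j
seq-pointℝ m i x k j with toℕ j ℕ.<? m | j Fin.≟ i
... | yes _ | _     = refl
... | no  _ | yes _ = refl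
... | no  _ | no  _ = refl

-- The fixed coordinates agree at both ends of the segment; only the free one uses `t * b ≡ x`.
pointℚ-convex : ∀ {n} m (i : Fin n) {x b} t → t ℚ.* b ≡ x → ∀ j →
  pointℚ m i x j ≡ (1ℚ ℚ.- t) ℚ.* pointℚ m i 0ℚ j ℚ.+ t ℚ.* pointℚ m i b j
pointℚ-convex m i {b = b} t refl j with toℕ j ℕ.<? m | j Fin.≟ i
... | yes _ | _     = solve 1 (λ t → con 1ℚ := (con 1ℚ :- t) :* con 1ℚ :+ t :* con 1ℚ) refl t
... | no  _ | yes _ =
  solve 2 (λ t b → t :* b := (con 1ℚ :- t) :* con 0ℚ :+ t :* b) refl t b
... | no  _ | no  _ = solve 1 (λ t → con 0ℚ := (con 1ℚ :- t) :* con 0ℚ :+ t :* con 0ℚ) refl t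

-- Splitting at `m`, the entries of the first block are all one and contribute their full weights,
-- while in the second block only coordinate `i` survives.
∑ℚ-pointℚ : ∀ m {n} K (c : Vector ℕ (m ℕ.+ n)) i → m ℕ.≤ toℕ i → ∀ q →
  ∑ℚ (λ j → ι (K ℕ.+ c j) ℚ.* pointℚ m i q j) ≡
  (ι (∑ (take m c)) ℚ.+ ι m ℚ.* ι K) ℚ.+ ι (K ℕ.+ c i) ℚ.* q
∑ℚ-pointℚ m {n} K c i m≤i q = trans (∑ℚ-split m f) (cong₂ ℚ._+_ left right)
  where
  f : Vector ℚ (m ℕ.+ n)
  f j = ι (K ℕ.+ c j) ℚ.* pointℚ m i q j

  i′ : Fin n
  i′ = reduce≥ i m≤i

  i′-eq : m ↑ʳ i′ ≡ i
  i′-eq = Fin.splitAt⁻¹-↑ʳ (Fin.splitAt-≥ m i m≤i)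

  left : ∑ℚ (take m f) ≡ ι (∑ (take m c)) ℚ.+ ι m ℚ.* ι K
  left = trans
    (Σℚ.sum-cong-≗ λ k → trans
      (cong (ι (K ℕ.+ c (k ↑ˡ n)) ℚ.*_)
        (template-< 0ℚ 1ℚ m i q (k ↑ˡ n)
          (subst (ℕ._< m) (sym (Fin.toℕ-↑ˡ k n)) (Fin.toℕ<n k))))
      (ℚ.*-identityʳ (ι (K ℕ.+ c (k ↑ˡ n)))))
    (∑ℚ-ι-shift K (take m c))

  right : ∑ℚ (drop m f) ≡ ι (K ℕ.+ c i) ℚ.* q
  right = trans
    (∑ℚ-single (drop m f) i′ λ k k≢i′ → trans
      (cong (ι (K ℕ.+ c (m ↑ʳ k)) ℚ.*_)
        (template-≢ 0ℚ 1ℚ m i q (m ↑ʳ k)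
          (subst (m ℕ.≤_) (sym (Fin.toℕ-↑ʳ m k)) (ℕ.m≤m+n m (toℕ k)))
          λ eq → k≢i′ (Fin.↑ʳ-injective m k i′ (trans eq (sym i′-eq)))))
      (ℚ.*-zeroʳ (ι (K ℕ.+ c (m ↑ʳ k)))))
    (trans (cong f i′-eq) (cong (ι (K ℕ.+ c i) ℚ.*_) (template-≡ 0ℚ 1ℚ m i q m≤i)))

-- Counting active constraints.

-- For an integral coordinate of the vertex this is its active box constraint: the value is one
-- exactly on the first `m` coordinates.
tightBox : ∀ {n} → ℕ → Fin n → BoxConstraint n
tightBox m j with toℕ j ℕ.<? m
... | yes _ = upper j
... | no  _ = lower j

coordinate : ∀ {n} → BoxConstraint n → Fin n
coordinate (lower j) = j
coordinate (upper j) = j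

tightBox-injective : ∀ {n} m {j k : Fin n} → tightBox m j ≡ tightBox m k → j ≡ k
tightBox-injective m {j} {k} eq =
  trans (sym (coordinate-tightBox j)) (trans (cong coordinate eq) (coordinate-tightBox k))
  where
  coordinate-tightBox : ∀ j → coordinate (tightBox m j) ≡ j
  coordinate-tightBox j with toℕ j ℕ.<? m
  ... | yes _ = refl
  ... | no  _ = refl

-- By `disjoint` an integral coordinate makes only one of its two box constraints active, and `ones`
-- tells which. Hence `tightBox m` carries a list of the integral coordinates to a list of the
-- active box constraints, without repetition or omission.
exactly-tightBoxes : ∀ {n k} m {Z O : Fin n → Set} {Q : BoxConstraint n → Set} →
  (∀ j → Q (lower j) ⇔ Z j) → (∀ j → Q (upper j) ⇔ O j) →
  (∀ j → Z j → ¬ O j) → (∀ j → O j ⇔ toℕ j ℕ.< m) →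
  Exactly k (λ j → Z j ⊎ O j) → Exactly k Q
exactly-tightBoxes m {Z} {O} {Q} lower⇔ upper⇔ disjoint ones (xs , uniq , len , mem) =
  map (tightBox m) xs , Unique.map⁺ (tightBox-injective m) uniq ,
  trans (length-map (tightBox m) xs) len , λ b → mk⇔ (sound b) (complete b)
  where
  tight : ∀ j → Z j ⊎ O j → Q (tightBox m j)
  tight j h with toℕ j ℕ.<? m | h
  ... | yes j<m | _      = Equivalence.from (upper⇔ j) (Equivalence.from (ones j) j<m)
  ... | no  _   | inj₁ z = Equivalence.from (lower⇔ j) z
  ... | no  j≮m | inj₂ o = contradiction (Equivalence.to (ones j) o) j≮m

  sound : ∀ b → b ∈ map (tightBox m) xs → Q b
  sound b b∈ with j , j∈xs , refl ← ∈-map⁻ (tightBox m) b∈ =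
    tight j (Equivalence.to (mem j) j∈xs)

  tightBox-lower : ∀ j → Z j → tightBox m j ≡ lower j
  tightBox-lower j z with toℕ j ℕ.<? m
  ... | yes j<m = contradiction (Equivalence.from (ones j) j<m) (disjoint j z)
  ... | no  _   = refl

  tightBox-upper : ∀ j → O j → tightBox m j ≡ upper j
  tightBox-upper j o with toℕ j ℕ.<? m
  ... | yes _   = refl
  ... | no  j≮m = contradiction (Equivalence.to (ones j) o) j≮m

  complete : ∀ b → Q b → b ∈ map (tightBox m) xs
  complete (lower j) h = subst (_∈ map (tightBox m) xs) (tightBox-lower j z)
    (∈-map⁺ (tightBox m) (Equivalence.from (mem j) (inj₁ z)))
    where z = Equivalence.to (lower⇔ j) h
  complete (upper j) h = subst (_∈ map (tightBox m) xs) (tightBox-upper j o)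
    (∈-map⁺ (tightBox m) (Equivalence.from (mem j) (inj₂ o)))
    where o = Equivalence.to (upper⇔ j) h

exactly-constraints : ∀ {n k} {P : Constraint n → Set} → P knapsackˢ → P knapsackᵈ →
  Exactly k (λ b → P (box b)) → Exactly (2 ℕ.+ k) P
exactly-constraints {P = P} pˢ pᵈ (bs , uniq , len , mem) =
  knapsackˢ ∷ knapsackᵈ ∷ map box bs ,
  ((λ ()) ∷ ∉⇒All≢ ˢ∉) ∷ ∉⇒All≢ ᵈ∉ ∷ Unique.map⁺ (λ { refl → refl }) uniq ,
  cong (2 ℕ.+_) (trans (length-map box bs) len) ,
  λ c → mk⇔ (sound c) (complete c)
  where
  ˢ∉ : knapsackˢ ∉ map box bs
  ˢ∉ h with _ , _ , () ← ∈-map⁻ box h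

  ᵈ∉ : knapsackᵈ ∉ map box bs
  ᵈ∉ h with _ , _ , () ← ∈-map⁻ box h

  sound : ∀ c → c ∈ knapsackˢ ∷ knapsackᵈ ∷ map box bs → P c
  sound _ (here refl)         = pˢ
  sound _ (there (here refl)) = pᵈ
  sound _ (there (there h)) with b , b∈ , refl ← ∈-map⁻ box h = Equivalence.to (mem b) b∈

  complete : ∀ c → P c → c ∈ knapsackˢ ∷ knapsackᵈ ∷ map box bs
  complete (box b)   h = there (there (∈-map⁺ box (Equivalence.from (mem b) h)))
  complete knapsackˢ _ = here refl
  complete knapsackᵈ _ = there (here refl)

-- Knapsack weights of the points in the polytope.

module _ (m : ℕ) (s : Vector ℕ (2 ℕ.* m)) where

  open Polytope m s

  -- Stated for any weight vector, so that `s` and `d` share the computations below.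
  Balanced : Vector ℕ (2 ℕ.* m) → Set
  Balanced c = ι (∑ (take m c)) ≡ ½ ℚ.* ι (∑ c)

  -- Complementing in `s-max` gives `∑ d + S = 2 m s-max`, and on the first half
  -- `∑ (take m d) + ∑ (take m s) = m s-max`. Doubling the latter and cancelling
  -- `S = 2 ∑ (take m s)` leaves `∑ d = 2 ∑ (take m d)`.
  balanced-d : Balanced s → Balanced d
  balanced-d h = trans (ι-half (∑ (take m d))) (cong (λ k → ½ ℚ.* ι k) (sym D≡T+T))
    where
    open ≡-Reasoning

    double : ∀ a b → 2 ℕ.* (a ℕ.+ b) ≡ (a ℕ.+ a) ℕ.+ (b ℕ.+ b)
    double = ℕ.solve-∀

    D≡T+T : ∑ d ≡ ∑ (take m d) ℕ.+ ∑ (take m d)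
    D≡T+T = ℕ.+-cancelʳ-≡ S (∑ d) (∑ (take m d) ℕ.+ ∑ (take m d)) (begin
      ∑ d ℕ.+ S
        ≡⟨ ∑-complement s-max s (≤-max s) ⟩
      2 ℕ.* m ℕ.* s-max
        ≡⟨ ℕ.*-assoc 2 m s-max ⟩
      2 ℕ.* (m ℕ.* s-max)
        ≡⟨ cong (2 ℕ.*_) (∑-complement s-max (take m s) (≤-max s ∘ (_↑ˡ (m ℕ.+ 0)))) ⟨
      2 ℕ.* (∑ (take m d) ℕ.+ ∑ (take m s))
        ≡⟨ double (∑ (take m d)) (∑ (take m s)) ⟩
      (∑ (take m d) ℕ.+ ∑ (take m d)) ℕ.+ (∑ (take m s) ℕ.+ ∑ (take m s))
        ≡⟨ cong ((∑ (take m d) ℕ.+ ∑ (take m d)) ℕ.+_) (ι-half⇒double (∑ (take m s)) S h) ⟨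
      (∑ (take m d) ℕ.+ ∑ (take m d)) ℕ.+ S ∎)

  weight-cong : ∀ c v w → (∀ j → v j ≈ w j) → weight c v ≈ weight c w
  weight-cong c v w h = ∑ℝ-cong
    (λ j → fromℚ (ι (M ℕ.+ c j)) * v j) (λ j → fromℚ (ι (M ℕ.+ c j)) * w j) λ j →
    *-congˡ (ι (M ℕ.+ c j)) {{ι-suc-pos (S ℕ.+ c j)}} (v j) (w j) (h j)

  module _ (i : Fin (2 ℕ.* m)) (m≤i : m ℕ.≤ toℕ i) where

    point : ℝ → Point
    point = pointℝ m i

    -- The bracketed constant is the capacity without its `ε`, so the knapsack inequality at
    -- `point x` reduces to `(M + c i) x ≤ ε`.
    seq-weight-point : ∀ c → Balanced c → ∀ x k → seq (weight c (point x)) k ≡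
      (½ ℚ.* ι (∑ c) ℚ.+ ι m ℚ.* ι M) ℚ.+ ι (M ℕ.+ c i) ℚ.* seq x k
    seq-weight-point c bal x k = begin
      seq (weight c (point x)) k
        ≡⟨ seq-∑ℝ (λ j → fromℚ (ι (M ℕ.+ c j)) * point x j) k ⟩
      ∑ℚ (λ j → ι (M ℕ.+ c j) ℚ.* seq (point x j) k)
        ≡⟨ Σℚ.sum-cong-≗ (λ j → cong (ι (M ℕ.+ c j) ℚ.*_) (seq-pointℝ m i x k j)) ⟩
      ∑ℚ (λ j → ι (M ℕ.+ c j) ℚ.* pointℚ m i (seq x k) j)
        ≡⟨ ∑ℚ-pointℚ m M c i m≤i (seq x k) ⟩
      (ι (∑ (take m c)) ℚ.+ ι m ℚ.* ι M) ℚ.+ ι (M ℕ.+ c i) ℚ.* seq x k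
        ≡⟨ cong (λ p → (p ℚ.+ ι m ℚ.* ι M) ℚ.+ ι (M ℕ.+ c i) ℚ.* seq x k) bal ⟩
      (½ ℚ.* ι (∑ c) ℚ.+ ι m ℚ.* ι M) ℚ.+ ι (M ℕ.+ c i) ℚ.* seq x k ∎
      where open ≡-Reasoning

    module _ (balˢ : Balanced s) (d≡s : d i ≡ s i)
             (b : ℚ) .{{b-pos : ℚ.Positive b}} (w*b≡ε : ι (M ℕ.+ s i) ℚ.* b ≡ ε) where

      private
        w : ℚ
        w = ι (M ℕ.+ s i)

        instance
          w-pos : ℚ.Positive w
          w-pos = ι-suc-pos (S ℕ.+ s i)

          w-nonNeg : ℚ.NonNegative w
          w-nonNeg = ℚ.pos⇒nonNeg w

          b-nonZero : ℚ.NonZero b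
          b-nonZero = ℚ.pos⇒nonZero b

      b≤1 : b ℚ.≤ 1ℚ
      b≤1 = ℚ.*-cancelˡ-≤-pos w (begin
        w ℚ.* b    ≡⟨ w*b≡ε ⟩
        -- The denominator `2 * M` of `ε` unfolds to `suc (S + (M + 0))`.
        ε          ≤⟨ 1/suc≤1 (S ℕ.+ (M ℕ.+ 0)) ⟩
        1ℚ         ≤⟨ ι-mono-≤ 1 (M ℕ.+ s i) (s≤s z≤n) ⟩
        w          ≡⟨ ℚ.*-identityʳ w ⟨
        w ℚ.* 1ℚ   ∎)
        where open ℚ.≤-Reasoning

      w*q≤ε : ∀ {q} → q ℚ.≤ b → w ℚ.* q ℚ.≤ ε
      w*q≤ε {q} q≤b = subst (w ℚ.* q ℚ.≤_) w*b≡ε (ℚ.*-monoˡ-≤-nonNeg w q≤b)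

      weight-point≤capacity : ∀ c → Balanced c → c i ≡ s i → ∀ {q} → q ℚ.≤ b →
        weight c (point (fromℚ q)) ≤ capacity c
      weight-point≤capacity c bal c≡s {q} q≤b =
        pointwise⇒≤ (weight c (point (fromℚ q))) (capacity c) λ k →
          subst (ℚ._≤ base ℚ.+ ε) (sym (seq-weight-point c bal (fromℚ q) k))
            (ℚ.+-monoʳ-≤ base
              (subst (λ l → ι (M ℕ.+ l) ℚ.* q ℚ.≤ ε) (sym c≡s) (w*q≤ε q≤b)))
        where
        base : ℚ
        base = ½ ℚ.* ι (∑ c) ℚ.+ ι m ℚ.* ι M

      -- As `c i ≡ s i`, the coefficient at `i` is `w`, and `w * b` fills exactly the slack `ε`; the
      -- same `b` thus saturates both knapsacks.
      weight-point≈capacity : ∀ c → Balanced c → c i ≡ s i →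
        weight c (point (fromℚ b)) ≈ capacity c
      weight-point≈capacity c bal c≡s =
        pointwise⇒≈ (weight c (point (fromℚ b))) (capacity c) λ k →
          trans (seq-weight-point c bal (fromℚ b) k)
            (cong (½ ℚ.* ι (∑ c) ℚ.+ ι m ℚ.* ι M ℚ.+_)
              (trans (cong (λ l → ι (M ℕ.+ l) ℚ.* b) c≡s) w*b≡ε))

      point-feasible : ∀ q → 0ℚ ℚ.≤ q → q ℚ.≤ b → Pᴿ (point (fromℚ q))
      point-feasible q 0≤q q≤b (box (lower j)) =
        template-elim 0ℝ 1ℝ m i (fromℚ q) (λ _ x → 0ℝ ≤ x)
          (λ _ _ → pointwise⇒≤ 0ℝ 1ℝ λ _ → ℚ.nonNegative⁻¹ 1ℚ)
          (pointwise⇒≤ 0ℝ (fromℚ q) λ _ → 0≤q)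
          (λ _ _ _ → pointwise⇒≤ 0ℝ 0ℝ λ _ → ℚ.≤-refl) j
      point-feasible q 0≤q q≤b (box (upper j)) =
        template-elim 0ℝ 1ℝ m i (fromℚ q) (λ _ x → x ≤ 1ℝ)
          (λ _ _ → pointwise⇒≤ 1ℝ 1ℝ λ _ → ℚ.≤-refl)
          (pointwise⇒≤ (fromℚ q) 1ℝ λ _ → ℚ.≤-trans q≤b b≤1)
          (λ _ _ _ → pointwise⇒≤ 0ℝ 1ℝ λ _ → ℚ.nonNegative⁻¹ 1ℚ) j
      point-feasible q 0≤q q≤b knapsackˢ = weight-point≤capacity s balˢ refl q≤b
      point-feasible q 0≤q q≤b knapsackᵈ =
        weight-point≤capacity d (balanced-d balˢ) d≡s q≤b

      -- The fractional coordinate of a vertex.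

      -- Quantifying over `x` allows two uses: with `v i` itself, and with `fromℚ b` once
      -- `v i ≈ fromℚ b` is known.
      module _ (v : Point) (v≈point : ∀ x → v i ≈ x → ∀ j → v j ≈ point x j) where

        -- The `s` knapsack suffices: with `ε` rewritten as `w * b`, first the common base and then
        -- the factor `w` cancel.
        fractional≤b : Pᴿ v → v i ≤ fromℚ b
        fractional≤b feasible = *-cancelˡ-≤ w (v i) (fromℚ b)
          (+-cancelˡ-≤ (fromℚ base) (fromℚ w * v i) (fromℚ w * fromℚ b)
            (≤-respˡ-≈ (weight s v) (fromℚ base + fromℚ w * v i) (fromℚ base + fromℚ w * fromℚ b)
              (≈-trans (weight s v) (weight s (point (v i))) (fromℚ base + fromℚ w * v i)
                (weight-cong s v (point (v i)) (v≈point (v i) (≈-refl (v i))))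
                (pointwise⇒≈ (weight s (point (v i))) (fromℚ base + fromℚ w * v i)
                  (seq-weight-point s balˢ (v i))))
              λ δ 0<δ → eventually-map
                (λ n → subst (λ p → seq (weight s v) n ℚ.≤ base ℚ.+ p ℚ.+ δ) (sym w*b≡ε))
                (feasible knapsackˢ δ 0<δ)))
          where
          base : ℚ
          base = ½ ℚ.* ι (∑ s) ℚ.+ ι m ℚ.* ι M

        -- Extremality would identify the two ends of the segment; at coordinate `i` this reads
        -- `0ℝ ≈ fromℚ b`, against `0 < b`.
        fractional≮b : IsVertex v → 0ℝ < v i → ¬ v i < fromℚ b
        fractional≮b (_ , extreme) 0<vᵢ vᵢ<b = <⇒≉ 0ℝ (fromℚ b) (fromℚ-mono-< 0<b)
          (subst₂ _≈_ (template-≡ 0ℝ 1ℝ m i 0ℝ m≤i) (template-≡ 0ℝ 1ℝ m i (fromℚ b) m≤i)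
            (extreme (point 0ℝ) (point (fromℚ b)) t
              (point-feasible 0ℚ ℚ.≤-refl (ℚ.<⇒≤ 0<b))
              (point-feasible b (ℚ.<⇒≤ 0<b) ℚ.≤-refl)
              -- Scaling `0 < v i < b` by `1/ b` gives `0 < t < 1`; the scaled bounds equal `0ℝ` and
              -- `1ℝ` only termwise.
              (<-resp-pointwise (fromℚ (1/ b) * 0ℝ) 0ℝ t t
                (λ _ → ℚ.*-zeroʳ (1/ b)) (λ _ → refl)
                (*-monoˡ-< (1/ b) {{1/b-pos}} 0ℝ (v i) 0<vᵢ))
              (<-resp-pointwise t t (fromℚ (1/ b) * fromℚ b) 1ℝ
                (λ _ → refl) (λ _ → ℚ.*-inverseˡ b)
                (*-monoˡ-< (1/ b) {{1/b-pos}} (v i) (fromℚ b) vᵢ<b))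
              between i))
          where
          1/b-pos : ℚ.Positive (1/ b)
          1/b-pos = ℚ.1/pos⇒pos b

          0<b : 0ℚ ℚ.< b
          0<b = ℚ.positive⁻¹ b

          t : ℝ
          t = fromℚ (1/ b) * v i

          t*b : ∀ x → (1/ b ℚ.* x) ℚ.* b ≡ x
          t*b x = trans (ℚ.*-comm (1/ b ℚ.* x) b) (*-quotient b x)

          between : ∀ j → v j ≈ (1ℝ - t) * point 0ℝ j + t * point (fromℚ b) j
          between j = ≈-trans (v j) (point (v i) j) ((1ℝ - t) * point 0ℝ j + t * point (fromℚ b) j)
            (v≈point (v i) (≈-refl (v i)) j)
            (pointwise⇒≈ (point (v i) j) ((1ℝ - t) * point 0ℝ j + t * point (fromℚ b) j) λ k →
              trans (seq-pointℝ m i (v i) k j)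
                (trans (pointℚ-convex m i (seq t k) (t*b (seq (v i) k)) j)
                  (sym (cong₂ (λ p q → (1ℚ ℚ.- seq t k) ℚ.* p ℚ.+ seq t k ℚ.* q)
                    (seq-pointℝ m i 0ℝ k j) (seq-pointℝ m i (fromℚ b) k j)))))

        fractional≈b : IsVertex v → 0ℝ < v i → v i ≈ fromℚ b
        fractional≈b vertex 0<vᵢ =
          ≤∧≮⇒≈ (v i) b (fractional≤b (proj₁ vertex)) (fractional≮b vertex 0<vᵢ)

        knapsack-active : IsVertex v → 0ℝ < v i → ∀ c → Balanced c → c i ≡ s i →
          weight c v ≈ capacity c
        knapsack-active vertex 0<vᵢ c bal c≡s =
          ≈-trans (weight c v) (weight c (point (fromℚ b))) (capacity c)
            (weight-cong c v (point (fromℚ b))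
              (v≈point (fromℚ b) (fractional≈b vertex 0<vᵢ)))
            (weight-point≈capacity c bal c≡s)

-- Activity of both knapsacks and the count of active constraints.

theorem1 : ∀ (m : ℕ) (s : Vector ℕ (2 ℕ.* m)) →
    1 ℕ.≤ m →
    (∀ j → 0 ℕ.< s j) →
    let open Polytope m s in
    ι (∑ (take m s)) ≡ ½ ℚ.* ι S →
    ∀ (v : Point) → IsVertex v →
    Exactly (2 ℕ.* m ∸ 1) (λ j → v j ≈ 0ℝ ⊎ v j ≈ 1ℝ) →
    (∀ j → v j ≈ 1ℝ ⇔ toℕ j ℕ.< m) →
    ∀ (i : Fin (2 ℕ.* m)) → 0ℝ < v i → v i < 1ℝ →
    ι (s i) ≡ ½ ℚ.* ι s-max →
    m ℕ.≤ toℕ i ×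
    IsDegenerate v ×
    Active v knapsackˢ ×
    Active v knapsackᵈ ×
    Exactly (2 ℕ.* m ∸ 1) (λ b → Active v (box b)) ×
    Exactly (2 ℕ.* m ℕ.+ 1) (Active v)
theorem1 m s 1≤m _ balˢ v vertex integral@(xs , uniq , len , mem) ones i 0<vᵢ vᵢ<1 half =
  m≤i ,
  (2 ℕ.* m ℕ.+ 1 , ℕ.m<m+n (2 ℕ.* m) (s≤s z≤n) , allActive) ,
  activeˢ , activeᵈ , boxes , allActive
  where
  open Polytope m s

  m≤i : m ℕ.≤ toℕ i
  m≤i = ℕ.≮⇒≥ λ i<m → <⇒≉ (v i) 1ℝ vᵢ<1 (Equivalence.from (ones i) i<m)

  d≡s : d i ≡ s i
  -- From `s-max = s i + s i` the truncated subtraction leaves `s i`.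
  d≡s = trans (cong (_∸ s i) (ι-half⇒double (s i) s-max half)) (ℕ.m+n∸n≡m (s i) (s i))

  i∉xs : i ∉ xs
  i∉xs i∈xs =
    [ <⇒≉ 0ℝ (v i) 0<vᵢ ∘ ≈-sym (v i) 0ℝ , <⇒≉ (v i) 1ℝ vᵢ<1 ]′ (Equivalence.to (mem i) i∈xs)

  zero-or-one : ∀ j → j ≢ i → v j ≈ 0ℝ ⊎ v j ≈ 1ℝ
  zero-or-one j j≢i = Equivalence.to (mem j) (only-one-missing uniq len i∉xs j≢i)

  v≈point : ∀ x → v i ≈ x → ∀ j → v j ≈ pointℝ m i x j
  v≈point x vᵢ≈x = template-elim 0ℝ 1ℝ m i x (λ j y → v j ≈ y)
    (λ j j<m → Equivalence.from (ones j) j<m)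
    vᵢ≈x
    -- In the second half the value one is excluded by `ones`, so an integral coordinate there is
    -- zero.
    (λ j m≤j j≢i → fromInj₁
      (λ v≈1 → contradiction m≤j (ℕ.<⇒≱ (Equivalence.to (ones j) v≈1))) (zero-or-one j j≢i))

  w b : ℚ
  w = ι (M ℕ.+ s i)

  instance
    w-pos : ℚ.Positive w
    w-pos = ι-suc-pos (S ℕ.+ s i)

    w-nonZero : ℚ.NonZero w
    w-nonZero = ℚ.pos⇒nonZero w

  -- The value of the free coordinate that uses up the slack: `w * b = ε`.
  b = 1/ w ℚ.* ε

  b-pos : ℚ.Positive b
  b-pos = ℚ.positive (quotient-pos w (ℚ.positive⁻¹ ε {{ℚ.normalize-pos 1 (2 ℕ.* M)}}))

  active : ∀ c → Balanced m s c → c i ≡ s i → weight c v ≈ capacity c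
  active = knapsack-active m s i m≤i balˢ d≡s b {{b-pos}} (*-quotient w ε) v v≈point vertex 0<vᵢ

  activeˢ : Active v knapsackˢ
  activeˢ = active s balˢ refl

  activeᵈ : Active v knapsackᵈ
  activeᵈ = active d (balanced-d m s balˢ) d≡s

  boxes : Exactly (2 ℕ.* m ∸ 1) (λ b → Active v (box b))
  boxes = exactly-tightBoxes m
    (λ j → mk⇔ (≈-sym 0ℝ (v j)) (≈-sym (v j) 0ℝ)) (λ j → mk⇔ id id)
    (λ j v≈0 v≈1 → 0≉1 (≈-trans 0ℝ (v j) 1ℝ (≈-sym (v j) 0ℝ v≈0) v≈1))
    ones integral

  allActive : Exactly (2 ℕ.* m ℕ.+ 1) (Active v)
  allActive = subst (λ k → Exactly k (Active v))
    -- The count `2 + (2 * m ∸ 1)` equals `2 * m + 1` because `1 ≤ m` makes the truncated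
    -- subtraction exact.
    (trans (cong suc (ℕ.m+[n∸m]≡n (ℕ.≤-trans 1≤m (ℕ.m≤m+n m (m ℕ.+ 0)))))
      (ℕ.+-comm 1 (2 ℕ.* m)))
    (exactly-constraints activeˢ activeᵈ boxes)
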